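{- For every integer $k \geq 4$, \[ \gamma^+(\{K_4^3, F_{3,2}, J_k\}) = \frac{k-2}{2k-3}.\]
   Context: All hypergraphs are $3$-graphs (every edge has size $3$). For a $3$-graph $H$, the co-degree of a pair of vertices is the number of edges containing it; the minimum positive co-degree $\delta_2^+(H)$ is the largest $k$ such that every pair contained in some edge is contained in at least $k$ edges (it is $0$ for the edgeless graph). For a family $\mathcal{F}$, $\mathrm{co^+ex}(n,\mathcal{F})$ is the maximum of $\delta_2^+(H)$ over $n$-vertex $3$-graphs $H$ containing no member of $\mathcal{F}$ as a (not necessarily induced) subhypergraph, and $\gamma^+(\mathcal{F})=\lim_{n\to\infty}\mathrm{co^+ex}(n,\mathcal{F})/n$ (the limit exists). $K_4^3$ is the complete $3$-graph on $4$ vertices. $F_{3,2}$ is the $3$-graph on $\{1,2,3,4,5\}$ with edges $\{123,124,125,345\}$. For $k\geq 3$, $J_k$ is the $3$-graph on $[k+1]$ with edges $\{1ij : 2\leq i<j\leq k+1\}$. -}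

module Defs where

open import Data.Nat using (ℕ; zero; suc; _+_; _*_; _∸_; _≤_; _⊓_; _≡ᵇ_)
open import Data.Bool using (Bool; true; false; if_then_else_)
open import Data.Fin using (Fin; zero; suc; _<_)
open import Data.List using (List; []; _∷_; foldr; map; concatMap; allFin)
open import Data.Nat.ListAction using (sum)
open import Data.Product using (Σ; _×_; ∃; _,_)
open import Data.Empty using (⊥)
open import Data.Unit using (⊤)
open import Relation.Nullary using (¬_)
open import Relation.Binary.PropositionalEquality using (_≡_)
open import Function.Definitions using (Injective)

record ThreeGraph (n : ℕ) : Set where
  field
    edge     : Fin n → Fin n → Fin n → Bool
    sym₁₂    : ∀ x y z → edge x y z ≡ edge y x z
    sym₂₃    : ∀ x y z → edge x y z ≡ edge x z y
    loopless : ∀ x z → edge x x z ≡ false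
open ThreeGraph public

codeg : {n : ℕ} → ThreeGraph n → Fin n → Fin n → ℕ
codeg {n} H x y = sum (map (λ z → if edge H x y z then 1 else 0) (allFin n))

posCodegs : {n : ℕ} → ThreeGraph n → List ℕ
posCodegs {n} H =
  concatMap (λ x → concatMap (λ y →
    if codeg H x y ≡ᵇ 0 then [] else codeg H x y ∷ []) (allFin n)) (allFin n)

minList : List ℕ → ℕ
minList []       = 0
minList (c ∷ cs) = foldr _⊓_ c cs

-- minimum positive co-degree δ₂⁺(H) (0 for the edgeless 3-graph)
δ₂⁺ : {n : ℕ} → ThreeGraph n → ℕ
δ₂⁺ H = minList (posCodegs H)

Contains : {n v : ℕ} → ThreeGraph n → (Fin v → Fin v → Fin v → Set) → Set
Contains {n} {v} H F =
  Σ (Fin v → Fin n) λ φ → Injective _≡_ _≡_ φ ×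
    (∀ a b c → F a b c → edge H (φ a) (φ b) (φ c) ≡ true)

K43 : Fin 4 → Fin 4 → Fin 4 → Set
K43 a b c = (a < b) × (b < c)

-- F_{3,2} on Fin 5 (vertex i+1 of the paper is i here):
-- edges 123,124,125,345 become 012,013,014,234
F32 : Fin 5 → Fin 5 → Fin 5 → Set
F32 zero (suc zero) (suc (suc zero))                     = ⊤
F32 zero (suc zero) (suc (suc (suc zero)))               = ⊤
F32 zero (suc zero) (suc (suc (suc (suc zero))))         = ⊤
F32 (suc (suc zero)) (suc (suc (suc zero))) (suc (suc (suc (suc zero)))) = ⊤
F32 _ _ _ = ⊥

-- J_k on Fin (k+1) (paper vertex 1 is zero here): edges {0, i+1, j+1}, i<j<k
J : (k : ℕ) → Fin (suc k) → Fin (suc k) → Fin (suc k) → Set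
J k zero (suc i) (suc j) = i < j
J k _ _ _ = ⊥

Free : (k : ℕ) {n : ℕ} → ThreeGraph n → Set
Free k H = ¬ Contains H K43 × ¬ Contains H F32 × ¬ Contains H (J k)

IsCoPlusEx : (k n m : ℕ) → Set
IsCoPlusEx k n m =
  (Σ (ThreeGraph n) λ H → Free k H × δ₂⁺ H ≡ m) ×
  (∀ (H : ThreeGraph n) → Free k H → δ₂⁺ H ≤ m)

{-# OPTIONS --safe #-}
-- Upper bound.  Let x be a vertex whose link contains a clique a₁, …, aₜ with t ≥ 3 that no further
-- vertex extends.  For a vertex v let A be the number of i with x aᵢ v an edge and let B be the number
-- of ordered pairs (i, j) with aᵢ aⱼ v an edge.  Freeness of K₄³ and F₃,₂ together with maximality give
-- t A + B ≤ t (t − 1), and summing over v yields (2t − 1) δ₂⁺ ≤ (t − 1) n; since H is J_k-free,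
-- t ≤ k − 1.  A clique to start from exists unless the three pairs of every edge have disjoint
-- neighbourhoods, in which case 3 δ₂⁺ ≤ n.
--
-- Lower bound.  Take classes A₀, …, A_{k−2} of size n/(2k−3) each and B of size (k−2)n/(2k−3), with
-- edges aa′b for a, a′ in different classes Aᵢ and b in B; every covered pair has co-degree about
-- (k−2)n/(2k−3).
module Submission where

open import Defs
open import Data.Nat using (ℕ; suc; _+_; _*_; _∸_; _≤_)
open import Data.Product using (∃; _×_)

open import Data.Nat using (zero; z≤n; s≤s; _<_; _≡ᵇ_; _<?_; _≤?_; _/_; _%_)
import Data.Nat as ℕ
open import Data.Nat.Properties
open import Data.Nat.DivMod using (m≡m%n+[m/n]*n; [m+n]%n≡m%n; m<n⇒m%n≡m; m%n<n)
open import Data.Nat.Solver using (module +-*-Solver)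
open import Data.Nat.ListAction using () renaming (sum to sumᴸ)
open import Data.Bool using (Bool; true; false; if_then_else_)
import Data.Bool.Properties as Bool
open import Data.Fin using (Fin; zero; suc; toℕ; fromℕ<; punchIn)
import Data.Fin as Fin
import Data.Fin.Properties as Fin
open import Data.List using (List; []; _∷_; concatMap; allFin; tabulate)
open import Data.List.Properties using (map-tabulate)
open import Data.List.Membership.Propositional using (_∈_)
open import Data.List.Membership.Propositional.Properties
  using (∈-allFin; ∈-concatMap⁺; ∈-concatMap⁻)
import Data.List.Relation.Unary.Any as Any
open Any using (here; there)
open import Data.Vec using (lookup; []; _∷_)
open import Data.Vec.Relation.Unary.All using ([]; _∷_)
open import Data.Vec.Relation.Unary.AllPairs using ([]; _∷_)
open import Data.Vec.Relation.Unary.Unique.Propositional using (Unique)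
open import Data.Vec.Relation.Unary.Unique.Propositional.Properties using (lookup-injective)
import Data.Vec.Functional as Vector
open import Data.Product using (Σ; _,_; proj₂; ∃₂)
open import Data.Sum using (_⊎_; inj₁; inj₂)
open import Data.Empty using (⊥; ⊥-elim)
open import Function using (_∘_; mk⇔)
open import Relation.Nullary using (¬_; Dec; yes; no; does; contradiction)
open import Relation.Nullary.Decidable using (map′; dec-true; dec-false; does-⇔; ¬?; _×-dec_)
open import Relation.Binary using (tri<; tri≈; tri>)
open import Relation.Binary.PropositionalEquality
  using (_≡_; _≢_; refl; sym; trans; cong; cong₂; subst; subst₂)
open import Algebra.Properties.Semiring.Sum +-*-semiring
  using (sum; sum-cong-≗; sum-remove; ∑-distrib-+; ∑-comm; *-distribˡ-sum)

-- Finite sums of natural numbers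

sum-mono-≤ : ∀ {n} {f g : Fin n → ℕ} → (∀ i → f i ≤ g i) → sum f ≤ sum g
sum-mono-≤ {zero}  f≤g = z≤n
sum-mono-≤ {suc n} f≤g = +-mono-≤ (f≤g zero) (sum-mono-≤ (f≤g ∘ suc))

sum-const : ∀ n c → sum {n} (λ _ → c) ≡ n * c
sum-const zero    c = refl
sum-const (suc n) c = cong (c +_) (sum-const n c)

sum≤*-const : ∀ {n} {f : Fin n → ℕ} c → (∀ i → f i ≤ c) → sum f ≤ n * c
sum≤*-const {n} c f≤c = ≤-trans (sum-mono-≤ f≤c) (≤-reflexive (sum-const n c))

const-*≤sum : ∀ {n} {f : Fin n → ℕ} c → (∀ i → c ≤ f i) → n * c ≤ sum f
const-*≤sum {n} c c≤f = ≤-trans (≤-reflexive (sym (sum-const n c))) (sum-mono-≤ c≤f)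

sum≡0 : ∀ {n} {f : Fin n → ℕ} → (∀ i → f i ≡ 0) → sum f ≡ 0
sum≡0 {zero}  f≡0 = refl
sum≡0 {suc n} f≡0 = cong₂ _+_ (f≡0 zero) (sum≡0 (f≡0 ∘ suc))

sum≢0⇒∃ : ∀ {n} {f : Fin n → ℕ} → sum f ≢ 0 → ∃ λ i → f i ≢ 0
sum≢0⇒∃ {n} {f} sum≢0 = Fin.¬∀⟶∃¬ n _ (λ i → f i ℕ.≟ 0) (sum≢0 ∘ sum≡0)

const-*≤sum-except : ∀ {n} {f : Fin (suc n) → ℕ} c i → (∀ j → j ≢ i → c ≤ f j) →
                     n * c ≤ sum f
const-*≤sum-except {n} {f} c i c≤f = begin
  n * c                          ≤⟨ const-*≤sum c (λ j → c≤f (punchIn i j) (Fin.punchInᵢ≢i i j)) ⟩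
  sum (f ∘ punchIn i)            ≤⟨ m≤n+m _ (f i) ⟩
  f i + sum (f ∘ punchIn i)      ≡⟨ sum-remove {i = i} f ⟨
  sum f                          ∎
  where open ≤-Reasoning

ind : Bool → ℕ
ind b = if b then 1 else 0

ind≤1 : ∀ b → ind b ≤ 1
ind≤1 true  = ≤-refl
ind≤1 false = z≤n

ind≡0 : ∀ {b} → b ≢ true → ind b ≡ 0
ind≡0 {true}  b≢true = contradiction refl b≢true
ind≡0 {false} _      = refl

ind≢0 : ∀ {b} → ind b ≢ 0 → b ≡ true
ind≢0 {true}  _     = refl
ind≢0 {false} ind≢0 = contradiction refl ind≢0

sum-ind≤-except : ∀ {n} (b : Fin (suc n) → Bool) i → b i ≢ true → sum (ind ∘ b) ≤ n
sum-ind≤-except {n} b i bi≢true = begin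
  sum (ind ∘ b)                              ≡⟨ sum-remove {i = i} (ind ∘ b) ⟩
  ind (b i) + sum (ind ∘ b ∘ punchIn i)      ≡⟨ cong (_+ sum (ind ∘ b ∘ punchIn i)) (ind≡0 bi≢true) ⟩
  sum (ind ∘ b ∘ punchIn i)                  ≤⟨ sum≤*-const 1 (ind≤1 ∘ b ∘ punchIn i) ⟩
  n * 1                                      ≡⟨ *-identityʳ n ⟩
  n                                          ∎
  where open ≤-Reasoning

sum-ind≤1 : ∀ {n} (b : Fin n → Bool) →
            (∀ i j → i ≢ j → b i ≡ true → b j ≡ true → ⊥) → sum (ind ∘ b) ≤ 1
sum-ind≤1 {zero}  b unique = z≤n
sum-ind≤1 {suc n} b unique with Fin.any? (λ i → b i Bool.≟ true)
... | no  none     = ≤-trans (≤-reflexive (sum≡0 λ i → ind≡0 {b i} λ bi → none (i , bi))) z≤n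
... | yes (i , bi) = begin
  sum (ind ∘ b)                                ≡⟨ sum-remove {i = i} (ind ∘ b) ⟩
  ind (b i) + sum (ind ∘ b ∘ punchIn i)        ≡⟨ cong (ind (b i) +_) (sum≡0 λ j →
     ind≡0 {b (punchIn i j)} (unique i (punchIn i j) (Fin.punchInᵢ≢i i j ∘ sym) bi)) ⟩
  ind (b i) + 0                                ≤⟨ +-monoˡ-≤ 0 (ind≤1 (b i)) ⟩
  1                                            ∎
  where open ≤-Reasoning

sumᴸ-tabulate : ∀ {n} (f : Fin n → ℕ) → sumᴸ (tabulate f) ≡ sum f
sumᴸ-tabulate {zero}  f = refl
sumᴸ-tabulate {suc n} f = cong (f zero +_) (sumᴸ-tabulate (f ∘ suc))

-- Positive co-degrees

Edge : ∀ {n} → ThreeGraph n → Fin n → Fin n → Fin n → Set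
Edge H x y z = edge H x y z ≡ true

edge? : ∀ {n} (H : ThreeGraph n) x y z → Dec (Edge H x y z)
edge? H x y z = edge H x y z Bool.≟ true

codeg≡sum : ∀ {n} (H : ThreeGraph n) x y → codeg H x y ≡ sum (ind ∘ edge H x y)
codeg≡sum H x y =
  trans (cong sumᴸ (map-tabulate (λ z → z) (ind ∘ edge H x y))) (sumᴸ-tabulate (ind ∘ edge H x y))

-- `minList` folds with the head as base value, so the entry peeled off first is the second one; the
-- induction drops `e` and keeps `d` in front.
minList≤ : ∀ {c cs} → c ∈ cs → minList cs ≤ c
minList≤ {cs = d ∷ []}     (here refl)          = ≤-refl
minList≤ {cs = d ∷ e ∷ cs} (here refl)          =
  ≤-trans (m⊓n≤n e (minList (d ∷ cs))) (minList≤ {cs = d ∷ cs} (here refl))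
minList≤ {cs = d ∷ e ∷ cs} (there (here refl))  = m⊓n≤m e (minList (d ∷ cs))
minList≤ {cs = d ∷ e ∷ cs} (there (there c∈cs)) =
  ≤-trans (m⊓n≤n e (minList (d ∷ cs))) (minList≤ {cs = d ∷ cs} (there c∈cs))

-- Membership of some `c` rules out the empty list, on which `minList` defaults to 0.
≤minList : ∀ {d c cs} → c ∈ cs → (∀ {c} → c ∈ cs → d ≤ c) → d ≤ minList cs
≤minList {cs = c ∷ []}     _ d≤cs = d≤cs (here refl)
≤minList {cs = c ∷ e ∷ cs} _ d≤cs =
  ⊓-glb (d≤cs (there (here refl))) (≤minList {cs = c ∷ cs} (here refl) d≤c∷cs)
  where
  d≤c∷cs : ∀ {c′} → c′ ∈ c ∷ cs → _ ≤ c′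
  d≤c∷cs (here eq)    = d≤cs (here eq)
  d≤c∷cs (there c∈cs) = d≤cs (there (there c∈cs))

module _ {n} (H : ThreeGraph n) where

  nonzero-codeg : Fin n → Fin n → List ℕ
  nonzero-codeg x y = if codeg H x y ≡ᵇ 0 then [] else codeg H x y ∷ []

  ∈-nonzero-codeg : ∀ {x y} → codeg H x y ≢ 0 → codeg H x y ∈ nonzero-codeg x y
  ∈-nonzero-codeg {x} {y} ≢0 with codeg H x y
  ... | zero  = contradiction refl ≢0
  ... | suc _ = here refl

  ∈-nonzero-codeg⁻ : ∀ {x y c} → c ∈ nonzero-codeg x y → c ≡ codeg H x y × codeg H x y ≢ 0
  ∈-nonzero-codeg⁻ {x} {y} c∈ with codeg H x y
  ∈-nonzero-codeg⁻ (here eq) | suc _ = eq , λ ()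

  ∈-posCodegs : ∀ {x y} → codeg H x y ≢ 0 → codeg H x y ∈ posCodegs H
  ∈-posCodegs {x} {y} ≢0 =
    ∈-concatMap⁺ (λ x → concatMap (nonzero-codeg x) (allFin n)) {xs = allFin n} (Any.map (λ { refl →
      ∈-concatMap⁺ (nonzero-codeg x) (Any.map (λ { refl → ∈-nonzero-codeg ≢0 }) (∈-allFin y)) })
      (∈-allFin x))

  ∈-posCodegs⁻ : ∀ {c} → c ∈ posCodegs H → ∃₂ λ x y → c ≡ codeg H x y × codeg H x y ≢ 0
  ∈-posCodegs⁻ c∈ with Any.satisfied (∈-concatMap⁻ (λ x → concatMap (nonzero-codeg x) (allFin n)) {xs = allFin n} c∈)
  ... | x , c∈ₓ with Any.satisfied (∈-concatMap⁻ (nonzero-codeg x) {xs = allFin n} c∈ₓ)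
  ... | y , c∈ₓᵧ = x , y , ∈-nonzero-codeg⁻ c∈ₓᵧ

  Edge⇒codeg≢0 : ∀ {x y z} → Edge H x y z → codeg H x y ≢ 0
  Edge⇒codeg≢0 {x} {y} {z} e codeg≡0 = <⇒≢ 0<codeg (sym codeg≡0)
    where
    open ≤-Reasoning
    0<codeg : 1 ≤ codeg H x y
    0<codeg = begin
      1                         ≡⟨ cong ind e ⟨
      ind (edge H x y z)        ≤⟨ term≤sum z ⟩
      sum (ind ∘ edge H x y)    ≡⟨ codeg≡sum H x y ⟨
      codeg H x y               ∎
      where
      term≤sum : ∀ {n} {f : Fin n → ℕ} i → f i ≤ sum f
      term≤sum zero        = m≤m+n _ _
      term≤sum {f = f} (suc i) = ≤-trans (term≤sum {f = f ∘ suc} i) (m≤n+m _ (f zero))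

  codeg≢0⇒Edge : ∀ {x y} → codeg H x y ≢ 0 → ∃ λ z → Edge H x y z
  codeg≢0⇒Edge {x} {y} ≢0 with sum≢0⇒∃ (≢0 ∘ trans (codeg≡sum H x y))
  ... | z , ind≢ = z , ind≢0 ind≢

  δ₂⁺≤ : ∀ {x y z} → Edge H x y z → δ₂⁺ H ≤ sum (ind ∘ edge H x y)
  δ₂⁺≤ {x} {y} e = ≤-trans (minList≤ (∈-posCodegs (Edge⇒codeg≢0 e))) (≤-reflexive (codeg≡sum H x y))

  -- The given edge makes the list of positive co-degrees nonempty; each entry of that list belongs
  -- to a pair covered by some edge, to which the bound applies.
  ≤δ₂⁺ : ∀ {d x y z} → Edge H x y z →
         (∀ {x y z} → Edge H x y z → d ≤ sum (ind ∘ edge H x y)) → d ≤ δ₂⁺ H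
  ≤δ₂⁺ {d} e d≤ = ≤minList (∈-posCodegs (Edge⇒codeg≢0 e)) λ c∈ → lower (∈-posCodegs⁻ c∈)
    where
    lower : ∀ {c} → (∃₂ λ x y → c ≡ codeg H x y × codeg H x y ≢ 0) → d ≤ c
    lower (x , y , refl , ≢0) with codeg≢0⇒Edge ≢0
    ... | z , e′ = ≤-trans (d≤ e′) (≤-reflexive (sym (codeg≡sum H x y)))

  -- In these names the digits give the order in which the vertices of the edge appear afterwards.
  edge-132 : ∀ {x y z} → Edge H x y z → Edge H x z y
  edge-132 = trans (sym (sym₂₃ H _ _ _))

  edge-213 : ∀ {x y z} → Edge H x y z → Edge H y x z
  edge-213 = trans (sym (sym₁₂ H _ _ _))

  edge-231 : ∀ {x y z} → Edge H x y z → Edge H y z x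
  edge-231 = edge-132 ∘ edge-213

  edge-312 : ∀ {x y z} → Edge H x y z → Edge H z x y
  edge-312 = edge-213 ∘ edge-132

  edge⇒≢₁₂ : ∀ {x y z} → Edge H x y z → x ≢ y
  edge⇒≢₁₂ e refl with trans (sym e) (loopless H _ _)
  ... | ()

  edge⇒≢₁₃ : ∀ {x y z} → Edge H x y z → x ≢ z
  edge⇒≢₁₃ = edge⇒≢₁₂ ∘ edge-132

  edge⇒≢₂₃ : ∀ {x y z} → Edge H x y z → y ≢ z
  edge⇒≢₂₃ = edge⇒≢₁₃ ∘ edge-213

  -- Any two of the four vertices lie in one of the given edges, so looplessness makes them
  -- distinct. The same holds for the five vertices of `containsF32`.
  containsK43 : ∀ {w x y z} → Edge H w x y → Edge H w x z → Edge H w y z → Edge H x y z →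
                Contains H K43
  containsK43 {w} {x} {y} {z} wxy wxz wyz xyz =
    lookup vs , (λ {i} {j} → lookup-injective distinct i j) , edges
    where
    vs = w ∷ x ∷ y ∷ z ∷ []
    distinct : Unique vs
    distinct = (edge⇒≢₁₂ wxy ∷ edge⇒≢₁₃ wxy ∷ edge⇒≢₁₃ wxz ∷ [])
             ∷ (edge⇒≢₂₃ wxy ∷ edge⇒≢₂₃ wxz ∷ []) ∷ (edge⇒≢₂₃ wyz ∷ []) ∷ [] ∷ []
    edges : ∀ a b c → K43 a b c → Edge H (lookup vs a) (lookup vs b) (lookup vs c)
    edges zero (suc zero) (suc (suc zero)) _ = wxy
    edges zero (suc zero) (suc (suc (suc zero))) _ = wxz
    edges zero (suc (suc zero)) (suc (suc (suc zero))) _ = wyz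
    edges (suc zero) (suc (suc zero)) (suc (suc (suc zero))) _ = xyz
    edges zero zero _ (() , _)
    edges (suc _) zero _ (() , _)
    edges (suc zero) (suc zero) _ (s≤s () , _)
    edges (suc (suc _)) (suc zero) _ (s≤s () , _)
    edges (suc (suc _)) (suc (suc zero)) _ (s≤s (s≤s ()) , _)
    edges _ (suc (suc (suc zero))) (suc (suc (suc zero))) (_ , s≤s (s≤s (s≤s ())))
    edges _ (suc _) zero (_ , ())
    edges _ (suc _) (suc zero) (_ , s≤s ())
    edges _ (suc (suc _)) (suc (suc zero)) (_ , s≤s (s≤s ()))

  containsF32 : ∀ {p q a b c} → Edge H p q a → Edge H p q b → Edge H p q c → Edge H a b c →
                Contains H F32
  containsF32 {p} {q} {a} {b} {c} pqa pqb pqc abc =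
    lookup vs , (λ {i} {j} → lookup-injective distinct i j) , edges
    where
    vs = p ∷ q ∷ a ∷ b ∷ c ∷ []
    distinct : Unique vs
    distinct = (edge⇒≢₁₂ pqa ∷ edge⇒≢₁₃ pqa ∷ edge⇒≢₁₃ pqb ∷ edge⇒≢₁₃ pqc ∷ [])
             ∷ (edge⇒≢₂₃ pqa ∷ edge⇒≢₂₃ pqb ∷ edge⇒≢₂₃ pqc ∷ [])
             ∷ (edge⇒≢₁₂ abc ∷ edge⇒≢₁₃ abc ∷ []) ∷ (edge⇒≢₂₃ abc ∷ []) ∷ [] ∷ []
    edges : ∀ i j l → F32 i j l → Edge H (lookup vs i) (lookup vs j) (lookup vs l)
    edges zero (suc zero) (suc (suc zero)) _ = pqa
    edges zero (suc zero) (suc (suc (suc zero))) _ = pqb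
    edges zero (suc zero) (suc (suc (suc (suc zero)))) _ = pqc
    edges (suc (suc zero)) (suc (suc (suc zero))) (suc (suc (suc (suc zero)))) _ = abc

-- Cliques in links

-- For t ≥ 2 this is a copy of J_t, its vertices being distinct by looplessness.
record LinkClique {n} (H : ThreeGraph n) (t : ℕ) : Set where
  field
    centre : Fin n
    clique : Fin t → Fin n
    linked : ∀ {i j} → i ≢ j → Edge H centre (clique i) (clique j)

module _ {n} {H : ThreeGraph n} where

  containsJ : ∀ {r} → LinkClique H (suc (suc r)) → Contains H (J (suc (suc r)))
  containsJ {r} C = φ , (λ {i} {j} → φ-injective i j) , edges
    where
    open LinkClique C
    φ : Fin (suc (suc (suc r))) → Fin n
    φ zero    = centre
    φ (suc i) = clique i
    -- A clique vertex differs from the centre because the two lie in an edge with a further clique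
    -- vertex; the size `suc (suc r)` guarantees one.
    other : ∀ i → ∃ λ j → i ≢ j
    other i = punchIn i zero , Fin.punchInᵢ≢i i zero ∘ sym
    centre≢clique : ∀ i → centre ≢ clique i
    centre≢clique i = edge⇒≢₁₂ H (linked (proj₂ (other i)))
    φ-injective : ∀ i j → φ i ≡ φ j → i ≡ j
    φ-injective zero    zero    _  = refl
    φ-injective zero    (suc j) eq = contradiction eq (centre≢clique j)
    φ-injective (suc i) zero    eq = contradiction (sym eq) (centre≢clique i)
    φ-injective (suc i) (suc j) eq with i Fin.≟ j
    ... | yes i≡j = cong suc i≡j
    ... | no  i≢j = contradiction eq (edge⇒≢₂₃ H (linked i≢j))
    edges : ∀ a b c → J (suc (suc r)) a b c → Edge H (φ a) (φ b) (φ c)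
    edges zero (suc i) (suc j) i<j = linked (Fin.<⇒≢ i<j)

  extend : ∀ {t} (C : LinkClique H t) v →
           (∀ i → Edge H (LinkClique.centre C) (LinkClique.clique C i) v) → LinkClique H (suc t)
  extend C v joined = record { centre = centre ; clique = v Vector.∷ clique ; linked = linked′ }
    where
    open LinkClique C
    linked′ : ∀ {i j} → i ≢ j → Edge H centre ((v Vector.∷ clique) i) ((v Vector.∷ clique) j)
    linked′ {zero}  {zero}  i≢j = contradiction refl i≢j
    linked′ {zero}  {suc j} _   = edge-132 H (joined j)
    linked′ {suc i} {zero}  _   = joined i
    linked′ {suc i} {suc j} i≢j = linked (i≢j ∘ cong suc)

  linkTriangle : ∀ {x a b c} → Edge H x a b → Edge H x a c → Edge H x b c → LinkClique H 3
  linkTriangle {x} {a} {b} {c} xab xac xbc =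
    record { centre = x ; clique = lookup (a ∷ b ∷ c ∷ []) ; linked = linked }
    where
    linked : ∀ {i j} → i ≢ j →
             Edge H x (lookup (a ∷ b ∷ c ∷ []) i) (lookup (a ∷ b ∷ c ∷ []) j)
    linked {zero}           {zero}           i≢j = contradiction refl i≢j
    linked {zero}           {suc zero}       _   = xab
    linked {zero}           {suc (suc zero)} _   = xac
    linked {suc zero}       {zero}           _   = edge-132 H xab
    linked {suc zero}       {suc zero}       i≢j = contradiction refl i≢j
    linked {suc zero}       {suc (suc zero)} _   = xbc
    linked {suc (suc zero)} {zero}           _   = edge-132 H xac
    linked {suc (suc zero)} {suc zero}       _   = edge-132 H xbc
    linked {suc (suc zero)} {suc (suc zero)} i≢j = contradiction refl i≢j

-- Upper bound by double counting over a maximal link clique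

-- The ratio s / (2s + 1) increases with s. Raising s by d adds 2δd on the left and nd on the right,
-- and 2δ ≤ n follows from the bound at s by cancelling s.
ratio-mono-≤ : ∀ n δ {r} s → 1 ≤ s → s ≤ r → δ * suc (s + s) ≤ n * s → δ * suc (r + r) ≤ n * r
ratio-mono-≤ n δ {r} s@(suc _) 1≤s s≤r bound = begin
  δ * suc (r + r)                              ≡⟨ cong (λ r → δ * suc (r + r)) (m+[n∸m]≡n s≤r) ⟨
  δ * suc ((s + d) + (s + d))                  ≡⟨ split δ s d ⟩
  δ * suc (s + s) + (δ * 2) * d                ≤⟨ +-mono-≤ bound (*-monoˡ-≤ d 2δ≤n) ⟩
  n * s + n * d                                ≡⟨ *-distribˡ-+ n s d ⟨
  n * (s + d)                                  ≡⟨ cong (n *_) (m+[n∸m]≡n s≤r) ⟩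
  n * r                                        ∎
  where
  open ≤-Reasoning
  open +-*-Solver
  d = r ∸ s
  split : ∀ δ s d → δ * suc ((s + d) + (s + d)) ≡ δ * suc (s + s) + (δ * 2) * d
  split = solve 3 (λ δ s d → δ :* (con 1 :+ ((s :+ d) :+ (s :+ d)))
                          := δ :* (con 1 :+ (s :+ s)) :+ (δ :* con 2) :* d) refl
  double : ∀ δ s → δ * 2 * s ≡ δ * (s + s)
  double = solve 2 (λ δ s → δ :* con 2 :* s := δ :* (s :+ s)) refl
  2δ≤n : δ * 2 ≤ n
  2δ≤n = *-cancelʳ-≤ (δ * 2) n s (begin
    δ * 2 * s            ≡⟨ double δ s ⟩
    δ * (s + s)          ≤⟨ *-monoʳ-≤ δ (n≤1+n (s + s)) ⟩
    δ * suc (s + s)      ≤⟨ bound ⟩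
    n * s                ∎)

module _ {n} {H : ThreeGraph n} (K43-free : ¬ Contains H K43) (F32-free : ¬ Contains H F32) where

  module _ {s} (C : LinkClique H (suc s)) where
    open LinkClique C

    -- Together with the clique edge on the centre, aᵢ and aⱼ, these three edges would form K₄³.
    no-triangle : ∀ {i j v} → Edge H centre (clique i) v → Edge H centre (clique j) v →
                  ¬ Edge H (clique i) (clique j) v
    no-triangle xiv xjv ijv = K43-free (containsK43 H (linked λ { refl → edge⇒≢₁₂ H ijv refl }) xiv xjv ijv)

    -- Otherwise the pair aᵢ v has the centre, aⱼ and aₗ in its neighbourhood, and these three form
    -- an edge of the clique: a copy of F₃,₂.
    no-star : ∀ {i j l v} → Edge H centre (clique i) v → Edge H (clique i) (clique j) v →
              ¬ (j ≢ l × Edge H (clique i) (clique l) v)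
    no-star xiv ijv (j≢l , ilv) = F32-free
      (containsF32 H (edge-231 H xiv) (edge-132 H ijv) (edge-132 H ilv) (linked j≢l))

    -- If i differed from both, the pair formed by the centre and aᵢ would have aⱼ, aₗ and v as
    -- neighbours, and aⱼ aₗ v is an edge: again F₃,₂.
    meets : ∀ {i j l v} → Edge H centre (clique i) v → Edge H (clique j) (clique l) v →
            i ≡ j ⊎ i ≡ l
    meets {i} {j} {l} xiv jlv with i Fin.≟ j | i Fin.≟ l
    ... | yes i≡j | _       = inj₁ i≡j
    ... | no  _   | yes i≡l = inj₂ i≡l
    ... | no  i≢j | no  i≢l = ⊥-elim (F32-free (containsF32 H (linked i≢j) (linked i≢l) xiv jlv))

    -- `centreDeg` and `cliqueDeg` are the quantities A and B, for a clique of size t = `suc s`.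
    centreDeg : Fin n → ℕ
    centreDeg v = sum λ i → ind (edge H centre (clique i) v)

    cliqueDeg : Fin n → ℕ
    cliqueDeg v = sum λ i → sum λ j → ind (edge H (clique i) (clique j) v)

    -- If some centre-aᵢ-v is an edge, then every pair aⱼ aₗ in the link of v contains aᵢ, and there
    -- is at most one such pair; so each row of the sum defining cliqueDeg has at most one entry.
    weight≤ : 2 ≤ s → ∀ v → ¬ (∀ i → Edge H centre (clique i) v) →
              suc s * centreDeg v + cliqueDeg v ≤ suc s * s
    weight≤ 2≤s v notAll with Fin.any? (λ i → edge? H centre (clique i) v)
    ... | no none = begin
      suc s * centreDeg v + cliqueDeg v    ≡⟨ cong (λ a → suc s * a + cliqueDeg v) (sum≡0 λ i → ind≡0 (none ∘ (i ,_))) ⟩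
      suc s * 0 + cliqueDeg v              ≡⟨ cong (_+ cliqueDeg v) (*-zeroʳ (suc s)) ⟩
      cliqueDeg v                          ≤⟨ sum≤*-const s row≤ ⟩
      suc s * s                            ∎
      where
      open ≤-Reasoning
      row≤ : ∀ i → sum (λ j → ind (edge H (clique i) (clique j) v)) ≤ s
      row≤ i = sum-ind≤-except (λ j → edge H (clique i) (clique j) v) i (λ iiv → edge⇒≢₁₂ H iiv refl)
    ... | yes (p , xpv) with Fin.any? (λ i → Fin.any? (λ j → edge? H (clique i) (clique j) v))
    -- Here B = 0, and maximality supplies an index missing from A, so A ≤ t - 1.
    ...   | no none = begin
      suc s * centreDeg v + cliqueDeg v    ≡⟨ cong (suc s * centreDeg v +_) (sum≡0 λ i → sum≡0 λ j → ind≡0 λ ijv → none (i , j , ijv)) ⟩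
      suc s * centreDeg v + 0              ≡⟨ +-identityʳ _ ⟩
      suc s * centreDeg v                  ≤⟨ *-monoʳ-≤ (suc s) centreDeg≤ ⟩
      suc s * s                            ∎
      where
      open ≤-Reasoning
      centreDeg≤ : centreDeg v ≤ s
      centreDeg≤ with Fin.¬∀⟶∃¬ (suc s) _ (λ i → edge? H centre (clique i) v) notAll
      ... | i , ¬xiv = sum-ind≤-except (λ i → edge H centre (clique i) v) i ¬xiv
    ...   | yes (q , q′ , qq′v) = begin
      suc s * centreDeg v + cliqueDeg v    ≤⟨ +-mono-≤ (*-monoʳ-≤ (suc s) centreDeg≤1) (sum≤*-const 1 row≤1) ⟩
      suc s * 1 + suc s * 1                ≡⟨ *-distribˡ-+ (suc s) 1 1 ⟨
      -- This is where t ≥ 3 enters: 2t ≤ t (t - 1).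
      suc s * 2                            ≤⟨ *-monoʳ-≤ (suc s) 2≤s ⟩
      suc s * s                            ∎
      where
      open ≤-Reasoning
      centreDeg≤1 : centreDeg v ≤ 1
      centreDeg≤1 = sum-ind≤1 (λ i → edge H centre (clique i) v) unique
        where
        unique : ∀ i j → i ≢ j → Edge H centre (clique i) v → Edge H centre (clique j) v → ⊥
        -- Both indices lie in {q, q′}; being different they exhaust it, and `no-triangle` applies.
        unique i j i≢j xiv xjv with meets xiv qq′v | meets xjv qq′v
        ... | inj₁ refl | inj₁ refl = i≢j refl
        ... | inj₁ refl | inj₂ refl = no-triangle xiv xjv qq′v
        ... | inj₂ refl | inj₁ refl = no-triangle xjv xiv qq′v
        ... | inj₂ refl | inj₂ refl = i≢j refl
      row≤1 : ∀ i → sum (λ j → ind (edge H (clique i) (clique j) v)) ≤ 1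
      row≤1 i = sum-ind≤1 (λ j → edge H (clique i) (clique j) v) unique
        where
        unique : ∀ j l → j ≢ l → Edge H (clique i) (clique j) v → Edge H (clique i) (clique l) v → ⊥
        unique j l j≢l ijv ilv with meets xpv ijv | meets xpv ilv
        ... | inj₁ refl | _         = no-star xpv ijv (j≢l , ilv)
        ... | inj₂ refl | inj₁ refl = edge⇒≢₁₂ H ijv refl
        ... | inj₂ refl | inj₂ refl = j≢l refl

    -- The t pairs of the centre with a clique vertex give a sum of A of at least tδ, and the t (t -
    -- 1) ordered pairs inside the clique give a sum of B of at least t (t - 1) δ. Summing the
    -- weight inequality over v and cancelling t gives the claim.
    maximal⇒δ₂⁺≤ : 2 ≤ s → (∀ v → ¬ (∀ i → Edge H centre (clique i) v)) →
                   δ₂⁺ H * suc (s + s) ≤ n * s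
    maximal⇒δ₂⁺≤ 2≤s maximal = *-cancelˡ-≤ (suc s) (begin
      suc s * (δ₂⁺ H * suc (s + s))                        ≡⟨ rearrange s (δ₂⁺ H) ⟩
      suc s * (suc s * δ₂⁺ H) + suc s * (s * δ₂⁺ H)        ≤⟨ +-mono-≤ (*-monoʳ-≤ (suc s) centre≥) clique≥ ⟩
      suc s * sum centreDeg + sum cliqueDeg                ≡⟨ cong (_+ sum cliqueDeg) (*-distribˡ-sum (suc s) centreDeg) ⟩
      sum (λ v → suc s * centreDeg v) + sum cliqueDeg      ≡⟨ ∑-distrib-+ (λ v → suc s * centreDeg v) cliqueDeg ⟨
      sum (λ v → suc s * centreDeg v + cliqueDeg v)        ≤⟨ sum≤*-const _ (λ v → weight≤ 2≤s v (maximal v)) ⟩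
      n * (suc s * s)                                      ≡⟨ x∙yz≈y∙xz n (suc s) s ⟩
      suc s * (n * s)                                      ∎)
      where
      open ≤-Reasoning
      open import Algebra.Properties.CommutativeSemigroup *-commutativeSemigroup using (x∙yz≈y∙xz)
      open +-*-Solver
      rearrange : ∀ s d → suc s * (d * suc (s + s)) ≡ suc s * (suc s * d) + suc s * (s * d)
      rearrange = solve 2 (λ s d →
        let t = con 1 :+ s in
        t :* (d :* (con 1 :+ (s :+ s))) := t :* (t :* d) :+ t :* (s :* d)) refl
      0<s : 0 < s
      0<s = ≤-trans (s≤s z≤n) 2≤s
      other : ∀ i → ∃ λ j → i ≢ j
      other i = punchIn i (fromℕ< 0<s) , Fin.punchInᵢ≢i i (fromℕ< 0<s) ∘ sym
      centre≥ : suc s * δ₂⁺ H ≤ sum centreDeg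
      centre≥ = begin
        suc s * δ₂⁺ H                                             ≤⟨ const-*≤sum _ (λ i → δ₂⁺≤ H (linked (proj₂ (other i)))) ⟩
        sum (λ i → sum λ v → ind (edge H centre (clique i) v))    ≡⟨ ∑-comm (λ i v → ind (edge H centre (clique i) v)) ⟩
        sum centreDeg                                             ∎
      clique≥ : suc s * (s * δ₂⁺ H) ≤ sum cliqueDeg
      clique≥ = begin
        -- Each row omits its diagonal entry, where no co-degree bound is available, leaving s
        -- terms.
        suc s * (s * δ₂⁺ H)                                       ≤⟨ const-*≤sum _ (λ i → const-*≤sum-except _ i λ j j≢i →
                                                                       δ₂⁺≤ H (edge-231 H (linked (j≢i ∘ sym)))) ⟩
        sum (λ i → sum λ j → sum λ v → e i j v)                   ≡⟨ sum-cong-≗ (λ i → ∑-comm (e i)) ⟩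
        sum (λ i → sum λ v → sum λ j → e i j v)                   ≡⟨ ∑-comm (λ i v → sum λ j → e i j v) ⟩
        sum cliqueDeg                                             ∎
        where
        e : Fin (suc s) → Fin (suc s) → Fin n → ℕ
        e i j v = ind (edge H (clique i) (clique j) v)

  module _ {r} (J-free : ¬ Contains H (J (suc (suc r)))) where

    -- The fuel `f` counts the vertices still missing from a clique of size r + 2 = k. Running out
    -- of fuel yields J_k; getting stuck earlier yields a maximal clique with s ≤ r, whose bound is
    -- carried up to r by monotonicity of the ratio.
    grow : ∀ f {s} → s + f ≡ suc r → 2 ≤ s → LinkClique H (suc s) → δ₂⁺ H * suc (r + r) ≤ n * r
    grow zero    {s} s+f≡ 2≤s C =
      contradiction (containsJ (subst (LinkClique H ∘ suc) (trans (sym (+-identityʳ s)) s+f≡) C)) J-free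
    grow (suc f) {s} s+f≡ 2≤s C
      with Fin.any? (λ v → Fin.all? (λ i → edge? H (LinkClique.centre C) (LinkClique.clique C i) v))
    ... | yes (v , joined) = grow f (trans (sym (+-suc s f)) s+f≡) (m≤n⇒m≤1+n 2≤s) (extend C v joined)
    ... | no  maximal      = ratio-mono-≤ n (δ₂⁺ H) s (≤-trans (s≤s z≤n) 2≤s) s≤r
                               (maximal⇒δ₂⁺≤ C 2≤s λ v joined → maximal (v , joined))
      where
      s≤r : s ≤ r
      s≤r = ≤-trans (m≤m+n s f) (≤-reflexive (suc-injective (trans (sym (+-suc s f)) s+f≡)))

    -- If v is a common neighbour of two pairs of the edge, then in the link of the vertex shared by
    -- these pairs the other two vertices and v form a triangle, from which a clique can grow.
    edge⇒δ₂⁺≤ : 2 ≤ r → ∀ {x y z} → Edge H x y z → δ₂⁺ H * suc (r + r) ≤ n * r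
    edge⇒δ₂⁺≤ 2≤r {x} {y} {z} xyz = by-cases
      (Fin.any? λ v → edge? H x y v ×-dec edge? H x z v)
      (Fin.any? λ v → edge? H x y v ×-dec edge? H y z v)
      (Fin.any? λ v → edge? H x z v ×-dec edge? H y z v)
      where
      start : LinkClique H 3 → δ₂⁺ H * suc (r + r) ≤ n * r
      start = grow (suc r ∸ 2) (m+[n∸m]≡n (m≤n⇒m≤1+n 2≤r)) ≤-refl
      by-cases : Dec (∃ λ v → Edge H x y v × Edge H x z v) →
                 Dec (∃ λ v → Edge H x y v × Edge H y z v) →
                 Dec (∃ λ v → Edge H x z v × Edge H y z v) → δ₂⁺ H * suc (r + r) ≤ n * r
      by-cases (yes (v , xyv , xzv)) _ _ = start (linkTriangle xyz xyv xzv)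
      by-cases (no _) (yes (v , xyv , yzv)) _ = start (linkTriangle (edge-213 H xyz) (edge-213 H xyv) yzv)
      by-cases (no _) (no _) (yes (v , xzv , yzv)) = start (linkTriangle (edge-312 H xyz) (edge-213 H xzv) (edge-213 H yzv))
      by-cases (no d₁) (no d₂) (no d₃) =
        -- Disjoint neighbourhoods give 3δ ≤ n, which is the instance s = 1 of the bound.
        ratio-mono-≤ n (δ₂⁺ H) 1 ≤-refl (≤-trans (s≤s z≤n) 2≤r) (begin
          δ₂⁺ H * 3                                            ≡⟨ triple (δ₂⁺ H) ⟩
          δ₂⁺ H + (δ₂⁺ H + δ₂⁺ H)                              ≤⟨ +-mono-≤ (δ₂⁺≤ H xyz) (+-mono-≤ (δ₂⁺≤ H (edge-132 H xyz)) (δ₂⁺≤ H (edge-231 H xyz))) ⟩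
          sum (e x y) + (sum (e x z) + sum (e y z))            ≡⟨ cong (sum (e x y) +_) (∑-distrib-+ (e x z) (e y z)) ⟨
          sum (e x y) + sum (λ v → e x z v + e y z v)          ≡⟨ ∑-distrib-+ (e x y) _ ⟨
          sum (λ v → e x y v + (e x z v + e y z v))            ≤⟨ sum≤*-const 1 disjoint ⟩
          n * 1                                                ∎)
        where
        open ≤-Reasoning
        e : Fin n → Fin n → Fin n → ℕ
        e x y v = ind (edge H x y v)
        triple : ∀ d → d * 3 ≡ d + (d + d)
        triple = +-*-Solver.solve 1 (λ d → d :* con 3 := d :+ (d :+ d)) refl
          where open +-*-Solver
        disjoint : ∀ v → e x y v + (e x z v + e y z v) ≤ 1
        disjoint v with edge H x y v in xyv | edge H x z v in xzv | edge H y z v in yzv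
        ... | true  | true  | _     = contradiction (v , xyv , xzv) d₁
        ... | true  | false | true  = contradiction (v , xyv , yzv) d₂
        ... | true  | false | false = ≤-refl
        ... | false | true  | true  = contradiction (v , xzv , yzv) d₃
        ... | false | true  | false = ≤-refl
        ... | false | false | b     = ind≤1 b

-- Writing k = r + 2 turns (k - 2) / (2k - 3) into r / (2r + 1). A graph with no edges has no
-- positive co-degree, so the default value 0 of `minList` applies.
δ₂⁺-upper : ∀ {n r} (H : ThreeGraph n) → 2 ≤ r → Free (suc (suc r)) H → δ₂⁺ H * suc (r + r) ≤ n * r
δ₂⁺-upper {n} {r} H 2≤r (K43-free , F32-free , J-free)
  with Fin.any? (λ x → Fin.any? (λ y → Fin.any? (λ z → edge? H x y z)))
... | yes (x , y , z , xyz) = edge⇒δ₂⁺≤ {H = H} K43-free F32-free J-free 2≤r xyz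
... | no  edgeless          = begin
  δ₂⁺ H * suc (r + r)    ≡⟨ cong (_* suc (r + r)) (δ₂⁺≡0 (posCodegs H) refl) ⟩
  0                      ≤⟨ z≤n ⟩
  n * r                  ∎
  where
  open ≤-Reasoning
  δ₂⁺≡0 : ∀ cs → cs ≡ posCodegs H → minList cs ≡ 0
  δ₂⁺≡0 []       _  = refl
  δ₂⁺≡0 (c ∷ cs) eq with ∈-posCodegs⁻ H (subst (c ∈_) eq (here refl))
  ... | x , y , _ , ≢0 with codeg≢0⇒Edge H ≢0
  ... | z , xyz = contradiction (x , y , z , xyz) edgeless

-- Blow-ups of the extremal pattern

sumTo : ℕ → (ℕ → ℕ) → ℕ
sumTo n f = sum {n} (f ∘ toℕ)

sumTo-+ : ∀ m n f → sumTo (m + n) f ≡ sumTo m f + sumTo n (f ∘ (m +_))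
sumTo-+ zero    n f = refl
sumTo-+ (suc m) n f = trans (cong (f 0 +_) (sumTo-+ m n (f ∘ suc))) (sym (+-assoc (f 0) _ _))

-- Split off the first d terms, which run once through all residues, and use periodicity for the
-- rest; after q rounds the last m terms are discarded.
periods≤sumTo : ∀ d .{{_ : ℕ.NonZero d}} q m f → q * sumTo d f ≤ sumTo (q * d + m) (λ v → f (v % d))
periods≤sumTo d zero    m f = z≤n
periods≤sumTo d (suc q) m f = begin
  sumTo d f + q * sumTo d f                                  ≤⟨ +-monoʳ-≤ (sumTo d f) (periods≤sumTo d q m f) ⟩
  sumTo d f + sumTo (q * d + m) g                            ≡⟨ cong₂ _+_ (sum-cong-≗ {d} λ i → cong f (sym (m<n⇒m%n≡m (Fin.toℕ<n i))))
                                                                          (sum-cong-≗ {q * d + m} λ i → cong f (shift (toℕ i))) ⟩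
  sumTo d g + sumTo (q * d + m) (g ∘ (d +_))                 ≡⟨ sumTo-+ d (q * d + m) g ⟨
  sumTo (d + (q * d + m)) g                                  ≡⟨ cong (λ n → sumTo n g) (+-assoc d (q * d) m) ⟨
  sumTo (d + q * d + m) g                                    ∎
  where
  open ≤-Reasoning
  g : ℕ → ℕ
  g v = f (v % d)
  shift : ∀ v → v % d ≡ (d + v) % d
  shift v = trans (sym ([m+n]%n≡m%n v d)) (cong (_% d) (+-comm v d))

exactlyOne : Bool → Bool → Bool → Bool
exactlyOne true  true  _     = false
exactlyOne true  false true  = false
exactlyOne true  false false = true
exactlyOne false true  true  = false
exactlyOne false true  false = true
exactlyOne false false c     = c

exactlyOne-213 : ∀ a b c → exactlyOne a b c ≡ exactlyOne b a c
exactlyOne-213 true  true  _     = refl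
exactlyOne-213 true  false true  = refl
exactlyOne-213 true  false false = refl
exactlyOne-213 false true  true  = refl
exactlyOne-213 false true  false = refl
exactlyOne-213 false false _     = refl

exactlyOne-132 : ∀ a b c → exactlyOne a b c ≡ exactlyOne a c b
exactlyOne-132 true  true  true  = refl
exactlyOne-132 true  true  false = refl
exactlyOne-132 true  false true  = refl
exactlyOne-132 true  false false = refl
exactlyOne-132 false true  true  = refl
exactlyOne-132 false true  false = refl
exactlyOne-132 false false true  = refl
exactlyOne-132 false false false = refl

-- Two edges sharing two vertices must agree on whether their third vertex is in B. This drives the
-- exclusion of both K₄³ and F₃,₂.
exactlyOne-unique : ∀ a b {c d} → exactlyOne a b c ≡ true → exactlyOne a b d ≡ true → c ≡ d
exactlyOne-unique true  false {false} {false} _ _ = refl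
exactlyOne-unique false true  {false} {false} _ _ = refl
exactlyOne-unique false false p q = trans p (sym q)

exactlyOne-constant : ∀ a → exactlyOne a a a ≢ true
exactlyOne-constant true  ()
exactlyOne-constant false ()

does⇒ : ∀ {A : Set} (a? : Dec A) → does a? ≡ true → A
does⇒ (yes a) _ = a

module Construction (r : ℕ) where

  -- Colours 0, …, r are the classes A₀, …, Aᵣ; the colours above r together make up the class B.
  isB : ℕ → Bool
  isB c = does (r <? c)

  -- A symmetric way of asking for one colour in B and two different colours among the classes Aᵢ.
  record Pattern (a b c : ℕ) : Set where
    constructor mkPattern
    field
      one : exactlyOne (isB a) (isB b) (isB c) ≡ true
      a≢b : a ≢ b
      b≢c : b ≢ c
      a≢c : a ≢ c
  open Pattern

  pattern? : ∀ a b c → Dec (Pattern a b c)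
  pattern? a b c = map′ (λ (one , a≢b , b≢c , a≢c) → mkPattern one a≢b b≢c a≢c)
                        (λ (mkPattern one a≢b b≢c a≢c) → one , a≢b , b≢c , a≢c)
    ((_ Bool.≟ true) ×-dec ¬? (a ℕ.≟ b) ×-dec ¬? (b ℕ.≟ c) ×-dec ¬? (a ℕ.≟ c))

  pattern-213 : ∀ {a b c} → Pattern a b c → Pattern b a c
  pattern-213 {a} {b} {c} (mkPattern one a≢b b≢c a≢c) =
    mkPattern (trans (exactlyOne-213 (isB b) (isB a) (isB c)) one) (a≢b ∘ sym) a≢c b≢c

  pattern-132 : ∀ {a b c} → Pattern a b c → Pattern a c b
  pattern-132 {a} {b} {c} (mkPattern one a≢b b≢c a≢c) =
    mkPattern (trans (exactlyOne-132 (isB a) (isB c) (isB b)) one) a≢c (b≢c ∘ sym) a≢b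

  -- There are r + 1 colours for the classes Aᵢ and r for B, matching the proportions 1 / (2k - 3)
  -- and (k - 2) / (2k - 3).
  period : ℕ
  period = suc r + r

  patternCodeg : ℕ → ℕ → ℕ
  patternCodeg a b = sumTo period (λ c → ind (does (pattern? a b c)))

  isB-false : ∀ {c} → c ≤ r → isB c ≡ false
  isB-false {c} c≤r = dec-false (r <? c) (≤⇒≯ c≤r)

  isB-true : ∀ {c} → r < c → isB c ≡ true
  isB-true {c} = dec-true (r <? c)

  isB-false⇒ : ∀ {c} → isB c ≡ false → c ≤ r
  isB-false⇒ {c} isA = ≮⇒≥ λ r<c → Bool.not-¬ isA (isB-true r<c)

  one-AAB : ∀ {a b c} → a ≤ r → b ≤ r → r < c → exactlyOne (isB a) (isB b) (isB c) ≡ true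
  one-AAB a≤r b≤r r<c rewrite isB-false a≤r | isB-false b≤r = isB-true r<c

  one-ABA : ∀ {a b c} → a ≤ r → r < b → c ≤ r → exactlyOne (isB a) (isB b) (isB c) ≡ true
  one-ABA {a} {b} {c} a≤r r<b c≤r =
    trans (exactlyOne-132 (isB a) (isB b) (isB c)) (one-AAB a≤r c≤r r<b)

  one-BAA : ∀ {a b c} → r < a → b ≤ r → c ≤ r → exactlyOne (isB a) (isB b) (isB c) ≡ true
  one-BAA {a} {b} {c} r<a b≤r c≤r =
    trans (exactlyOne-213 (isB a) (isB b) (isB c)) (one-ABA b≤r r<a c≤r)

  -- Two A colours are completed by each of the r colours of B; an A colour and a B colour by each
  -- of the r other A colours. Two B colours are never covered.
  patternCodeg≥ : ∀ {a b c} → Pattern a b c → r ≤ patternCodeg a b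
  patternCodeg≥ {a} {b} {c} (mkPattern one a≢b _ _) = by-class (a ≤? r) (b ≤? r)
    where
    open ≤-Reasoning
    f : ℕ → ℕ
    f c = ind (does (pattern? a b c))
    1≤f : ∀ {c} → Pattern a b c → 1 ≤ f c
    1≤f p = ≤-reflexive (sym (cong ind (dec-true (pattern? a b _) p)))
    through-A : ∀ {a′} → a′ ≤ r → (∀ {c} → c ≤ r → c ≢ a′ → Pattern a b c) → r ≤ patternCodeg a b
    through-A {a′} a′≤r pat = begin
      r                                                 ≡⟨ *-identityʳ r ⟨
      r * 1                                             ≤⟨ const-*≤sum-except 1 (fromℕ< (s≤s a′≤r)) (λ i i≢ →
                                                             1≤f (pat (≤-pred (Fin.toℕ<n i)) λ i≡a′ → i≢ (Fin.toℕ-injective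
                                                               (trans i≡a′ (sym (Fin.toℕ-fromℕ< (s≤s a′≤r))))))) ⟩
      sumTo (suc r) f                                   ≤⟨ m≤m+n _ _ ⟩
      sumTo (suc r) f + sumTo r (f ∘ (suc r +_))        ≡⟨ sumTo-+ (suc r) r f ⟨
      patternCodeg a b                                  ∎
    through-B : (∀ {c} → r < c → Pattern a b c) → r ≤ patternCodeg a b
    through-B pat = begin
      r                                                 ≡⟨ *-identityʳ r ⟨
      r * 1                                             ≤⟨ const-*≤sum {r} 1 (λ i → 1≤f (pat (s≤s (m≤m+n r (toℕ i))))) ⟩
      sumTo r (f ∘ (suc r +_))                          ≤⟨ m≤n+m _ (sumTo (suc r) f) ⟩
      sumTo (suc r) f + sumTo r (f ∘ (suc r +_))        ≡⟨ sumTo-+ (suc r) r f ⟨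
      patternCodeg a b                                  ∎
    by-class : Dec (a ≤ r) → Dec (b ≤ r) → r ≤ patternCodeg a b
    by-class (yes a≤r) (yes b≤r) = through-B λ r<c →
      mkPattern (one-AAB a≤r b≤r r<c) a≢b (λ { refl → <⇒≱ r<c b≤r }) (λ { refl → <⇒≱ r<c a≤r })
    by-class (yes a≤r) (no b≰r) = through-A a≤r λ c≤r c≢a →
      mkPattern (one-ABA a≤r (≰⇒> b≰r) c≤r) a≢b (λ { refl → b≰r c≤r }) (c≢a ∘ sym)
    by-class (no a≰r) (yes b≤r) = through-A b≤r λ c≤r c≢b →
      mkPattern (one-BAA (≰⇒> a≰r) b≤r c≤r) a≢b (c≢b ∘ sym) (λ { refl → a≰r c≤r })
    by-class (no a≰r) (no b≰r) = contradiction one two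
      where
      two : exactlyOne (isB a) (isB b) (isB c) ≢ true
      two rewrite isB-true (≰⇒> a≰r) | isB-true (≰⇒> b≰r) = λ ()

  module _ (n : ℕ) where

    -- Residues spread the vertices almost evenly over the colours for every n, whether or not the
    -- period divides it.
    colour : Fin n → ℕ
    colour v = toℕ v % period

    blowUp : ThreeGraph n
    blowUp = record
      { edge     = λ x y z → does (pattern? (colour x) (colour y) (colour z))
      ; sym₁₂    = λ x y z → does-⇔ (mk⇔ pattern-213 pattern-213)
                               (pattern? (colour x) (colour y) (colour z)) (pattern? (colour y) (colour x) (colour z))
      ; sym₂₃    = λ x y z → does-⇔ (mk⇔ pattern-132 pattern-132)
                               (pattern? (colour x) (colour y) (colour z)) (pattern? (colour x) (colour z) (colour y))
      ; loopless = λ x z → dec-false (pattern? (colour x) (colour x) (colour z)) λ p → a≢b p refl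
      }

    toPattern : ∀ x y z → Edge blowUp x y z → Pattern (colour x) (colour y) (colour z)
    toPattern x y z = does⇒ (pattern? (colour x) (colour y) (colour z))

    -- A copy of F projects to a homomorphism into the pattern, and the freeness proofs refute such
    -- homomorphisms.
    contains⇒pattern : ∀ {v} {F : Fin v → Fin v → Fin v → Set} → Contains blowUp F →
                       Σ (Fin v → ℕ) λ ψ → ∀ a b c → F a b c → Pattern (ψ a) (ψ b) (ψ c)
    contains⇒pattern (φ , _ , edges) =
      colour ∘ φ , λ a b c Fabc → toPattern (φ a) (φ b) (φ c) (edges a b c Fabc)

    -- Comparing abc with abd and with acd puts b, c and d on the same side of the partition, which
    -- the edge bcd forbids.
    blowUp-K43-free : ¬ Contains blowUp K43
    blowUp-K43-free K43⊆ with contains⇒pattern K43⊆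
    ... | ψ , patterns = exactlyOne-constant (isB d)
            (subst₂ (λ x y → exactlyOne x y (isB d) ≡ true) b≡d c≡d (one bcd))
      where
      a = ψ zero
      b = ψ (suc zero)
      c = ψ (suc (suc zero))
      d = ψ (suc (suc (suc zero)))
      abc : Pattern a b c
      abc = patterns _ _ _ (s≤s z≤n , s≤s (s≤s z≤n))
      abd : Pattern a b d
      abd = patterns zero (suc zero) (suc (suc (suc zero))) (s≤s z≤n , s≤s (s≤s z≤n))
      acd : Pattern a c d
      acd = patterns zero (suc (suc zero)) (suc (suc (suc zero))) (s≤s z≤n , s≤s (s≤s (s≤s z≤n)))
      bcd : Pattern b c d
      bcd = patterns (suc zero) (suc (suc zero)) (suc (suc (suc zero))) (s≤s (s≤s z≤n) , s≤s (s≤s (s≤s z≤n)))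
      c≡d : isB c ≡ isB d
      c≡d = exactlyOne-unique (isB a) (isB b) (one abc) (one abd)
      b≡d : isB b ≡ isB d
      b≡d = exactlyOne-unique (isB a) (isB c) (one (pattern-132 abc)) (one acd)

    -- The three edges through pq put a, b and c on the same side, which the edge abc forbids.
    blowUp-F32-free : ¬ Contains blowUp F32
    blowUp-F32-free F32⊆ with contains⇒pattern F32⊆
    ... | ψ , patterns = exactlyOne-constant (isB c)
            (subst₂ (λ x y → exactlyOne x y (isB c) ≡ true) a≡c b≡c (one abc))
      where
      p = ψ zero
      q = ψ (suc zero)
      a = ψ (suc (suc zero))
      b = ψ (suc (suc (suc zero)))
      c = ψ (suc (suc (suc (suc zero))))
      pqa : Pattern p q a
      pqa = patterns zero (suc zero) (suc (suc zero)) _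
      pqb : Pattern p q b
      pqb = patterns zero (suc zero) (suc (suc (suc zero))) _
      pqc : Pattern p q c
      pqc = patterns zero (suc zero) (suc (suc (suc (suc zero)))) _
      abc : Pattern a b c
      abc = patterns (suc (suc zero)) (suc (suc (suc zero))) (suc (suc (suc (suc zero)))) _
      a≡c : isB a ≡ isB c
      a≡c = exactlyOne-unique (isB p) (isB q) (one pqa) (one pqc)
      b≡c : isB b ≡ isB c
      b≡c = exactlyOne-unique (isB p) (isB q) (one pqb) (one pqc)

    -- The link of a vertex of B is (r+1)-partite, and that of a vertex outside B is bipartite.
    blowUp-J-free : 1 ≤ r → ¬ Contains blowUp (J (suc (suc r)))
    -- Matching on 1 ≤ r exposes a successor, so that the clique has the three vertices needed for
    -- the odd cycle below.
    blowUp-J-free (s≤s _) J⊆ with contains⇒pattern J⊆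
    ... | ψ , patterns = by-class (isB x) refl
      where
      x = ψ zero
      a = ψ ∘ suc
      linked : ∀ i j → i ≢ j → Pattern x (a i) (a j)
      linked i j i≢j with Fin.<-cmp i j
      ... | tri< i<j _ _ = patterns zero (suc i) (suc j) i<j
      ... | tri≈ _ i≡j _ = contradiction i≡j i≢j
      ... | tri> _ _ j<i = pattern-132 (patterns zero (suc j) (suc i) j<i)
      linked-in : ∀ {t} → isB x ≡ t → ∀ i j → i ≢ j → exactlyOne t (isB (a i)) (isB (a j)) ≡ true
      linked-in refl i j i≢j = one (linked i j i≢j)
      by-class : ∀ t → isB x ≡ t → ⊥
      -- The r + 2 clique vertices all have colours among 0, ..., r, so two of them share a class.
      by-class true x∈B = same-colour (Fin.pigeonhole ≤-refl (λ i → fromℕ< (s≤s (a≤r i))))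
        where
        others-false : ∀ b c → exactlyOne true b c ≡ true → b ≡ false
        others-false false _ _ = refl
        a≤r : ∀ i → a i ≤ r
        a≤r i = isB-false⇒ (others-false (isB (a i)) (isB (a (punchIn i zero)))
                  (linked-in x∈B i (punchIn i zero) (Fin.punchInᵢ≢i i zero ∘ sym)))
        same-colour : ¬ ∃₂ λ i j → i Fin.< j × fromℕ< (s≤s (a≤r i)) ≡ fromℕ< (s≤s (a≤r j))
        same-colour (i , j , i<j , eq) = b≢c (linked i j (Fin.<⇒≢ i<j))
          (Fin.fromℕ<-injective (a i) (a j) (s≤s (a≤r i)) (s≤s (a≤r j)) eq)
      by-class false x∉B = odd-cycle (isB (a zero)) (isB (a (suc zero))) (isB (a (suc (suc zero))))
          (linked-in x∉B zero (suc zero) λ ()) (linked-in x∉B zero (suc (suc zero)) λ ())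
          (linked-in x∉B (suc zero) (suc (suc zero)) λ ())
        where
        odd-cycle : ∀ p q s → exactlyOne false p q ≡ true → exactlyOne false p s ≡ true →
                    exactlyOne false q s ≢ true
        odd-cycle true  false false _ _ ()
        odd-cycle false true  true  _ _ ()

    ≤δ₂⁺-blowUp : 1 ≤ r → period ≤ n → (n / period) * r ≤ δ₂⁺ blowUp
    -- The vertices 0, 1 and r + 1 carry their own numbers as colours: A₀, A₁ and the first colour
    -- of B. They form the edge that `≤δ₂⁺` asks for.
    ≤δ₂⁺-blowUp 1≤r period≤n = ≤δ₂⁺ blowUp {x = vertex 0<period} {vertex 1<period} {vertex r+1<period}
      (dec-true (pattern? (colour (vertex 0<period)) (colour (vertex 1<period)) (colour (vertex r+1<period))) base)
      (λ {x} {y} {z} → codeg≥ x y z)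
      where
      0<period : 0 < period
      0<period = s≤s z≤n
      1<period : 1 < period
      1<period = s≤s (≤-trans 1≤r (m≤m+n r r))
      r+1<period : suc r < period
      r+1<period = s≤s (m<m+n r 1≤r)
      vertex : ∀ {c} → c < period → Fin n
      vertex c<period = fromℕ< (≤-trans c<period period≤n)
      colour-vertex : ∀ {c} (c<period : c < period) → colour (vertex c<period) ≡ c
      colour-vertex c<period =
        trans (cong (_% period) (Fin.toℕ-fromℕ< (≤-trans c<period period≤n))) (m<n⇒m%n≡m c<period)
      base : Pattern (colour (vertex 0<period)) (colour (vertex 1<period)) (colour (vertex r+1<period))
      base rewrite colour-vertex 0<period | colour-vertex 1<period | colour-vertex r+1<period
        = mkPattern (one-AAB z≤n 1≤r (n<1+n r)) (λ ()) (λ eq → <⇒≢ 1≤r (suc-injective eq)) (λ ())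
      codeg≥ : ∀ x y z → Edge blowUp x y z → (n / period) * r ≤ sum (ind ∘ edge blowUp x y)
      codeg≥ x y z e = begin
        (n / period) * r                                    ≤⟨ *-monoʳ-≤ (n / period) (patternCodeg≥ (toPattern x y z e)) ⟩
        (n / period) * patternCodeg (colour x) (colour y)   ≤⟨ periods≤sumTo period (n / period) (n % period) f ⟩
        sumTo ((n / period) * period + n % period) g        ≡⟨ cong (λ n → sumTo n g) (trans (+-comm _ (n % period)) (sym (m≡m%n+[m/n]*n n period))) ⟩
        sumTo n g                                           ∎
        where
        open ≤-Reasoning
        f g : ℕ → ℕ
        f c = ind (does (pattern? (colour x) (colour y) c))
        g v = f (v % period)

-- Convergence of the ratio

open Construction using (blowUp; blowUp-K43-free; blowUp-F32-free; blowUp-J-free; ≤δ₂⁺-blowUp)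

2*[2+r]∸3≡ : ∀ r → 2 * suc (suc r) ∸ 3 ≡ suc (r + r)
2*[2+r]∸3≡ r = cong (_∸ 3) (double r)
  where
  open +-*-Solver
  double : ∀ r → 2 * suc (suc r) ≡ 3 + suc (r + r)
  double = solve 1 (λ r → con 2 :* (con 2 :+ r) := con 4 :+ (r :+ r)) refl

-- Rounding n / d down loses less than d in n, hence at most rd in nr. Multiplied by `suc j`, this
-- loss is at most nd because r (j + 1) ≤ n.
quotient-bound : ∀ {n m r d j} .{{_ : ℕ.NonZero d}} → r * suc j ≤ n → (n / d) * r ≤ m →
                 (n * r) * suc j ≤ (m * d) * suc j + n * d
quotient-bound {n} {m} {r} {d} {j} r[1+j]≤n qr≤m = begin
  (n * r) * suc j                                ≡⟨ cong (λ n → (n * r) * suc j) (m≡m%n+[m/n]*n n d) ⟩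
  ((n % d + q * d) * r) * suc j                  ≤⟨ *-monoˡ-≤ (suc j) (*-monoˡ-≤ r (+-monoˡ-≤ (q * d) (<⇒≤ (m%n<n n d)))) ⟩
  ((d + q * d) * r) * suc j                      ≡⟨ rearrange d q r (suc j) ⟩
  ((q * r) * d) * suc j + (r * suc j) * d        ≤⟨ +-mono-≤ (*-monoˡ-≤ (suc j) (*-monoˡ-≤ d qr≤m)) (*-monoˡ-≤ d r[1+j]≤n) ⟩
  (m * d) * suc j + n * d                        ∎
  where
  open ≤-Reasoning
  open +-*-Solver
  q = n / d
  rearrange : ∀ d q r s → ((d + q * d) * r) * s ≡ ((q * r) * d) * s + (r * s) * d
  rearrange = solve 4 (λ d q r s → ((d :+ q :* d) :* r) :* s := ((q :* r) :* d) :* s :+ (r :* s) :* d) refl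

-- The limit with ε = 1 / (j + 1): after clearing denominators, the two inequalities say that m / n
-- is within ε of (k - 2) / (2k - 3).
theorem2p2 : ∀ (k : ℕ) → 4 ≤ k → ∀ (j : ℕ) → ∃ λ (N : ℕ) → ∀ (n m : ℕ) → N ≤ n → IsCoPlusEx k n m →
    ((m * (2 * k ∸ 3)) * suc j ≤ (n * (k ∸ 2)) * suc j + n * (2 * k ∸ 3))
    × ((n * (k ∸ 2)) * suc j ≤ (m * (2 * k ∸ 3)) * suc j + n * (2 * k ∸ 3))
-- The first summand of the threshold provides a full period of vertices, the second absorbs the
-- rounding loss.
theorem2p2 (suc (suc r)) (s≤s (s≤s 2≤r)) j rewrite 2*[2+r]∸3≡ r = suc (r + r) + r * suc j , bounds
  where
  1≤r : 1 ≤ r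
  1≤r = ≤-trans (s≤s z≤n) 2≤r
  bounds : ∀ n m → suc (r + r) + r * suc j ≤ n → IsCoPlusEx (suc (suc r)) n m →
           ((m * suc (r + r)) * suc j ≤ (n * r) * suc j + n * suc (r + r))
           × ((n * r) * suc j ≤ (m * suc (r + r)) * suc j + n * suc (r + r))
  bounds n m N≤n ((H , H-free , refl) , maximal) =
      -- The upper bound is exact for every n, so the error term is only added as slack.
      ≤-trans (*-monoˡ-≤ (suc j) (δ₂⁺-upper H 2≤r H-free)) (m≤m+n _ _)
    , quotient-bound {j = j} (≤-trans (m≤n+m _ (suc (r + r))) N≤n)
        (≤-trans (≤δ₂⁺-blowUp r n 1≤r (≤-trans (m≤m+n _ _) N≤n))
                 (maximal (blowUp r n) (blowUp-K43-free r n , blowUp-F32-free r n , blowUp-J-free r n 1≤r)))
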